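{- In the preemptive FIFO buffer management problem, let $B$ be an arbitrary initial buffer and let $B'=\emptyset$ be the empty buffer. For an input sequence $\sigma$, let $v(\mathrm{OPT}(B,\sigma))$ denote the total value transmitted by the optimal schedule operating on input $\sigma$ starting from buffer $B$ (and similarly for $B'$). Then $$v(\mathrm{OPT}(B',\sigma))-\varepsilon\ \le\ v(\mathrm{OPT}(B,\sigma))\ \le\ v(\mathrm{OPT}(B',\sigma))+\varepsilon,$$ where $\varepsilon=|v(B)-v(B')|=v(B)$ is the total value of the packets in the initial buffer $B$.
   Context: Preemptive FIFO buffer management. A buffer has fixed finite capacity. Time is discrete, $i\in\{1,\dots,T\}$. An input is $\sigma=(\sigma_1,\dots,\sigma_T)$, where $\sigma_i=(p_{i_1},\dots,p_{i_k})$, $k\in\mathbb{Z}_+$, is the sequence of packets arriving at step $i$; each packet $p$ has a nonnegative real value $v(p)$. Each step has two phases. Arrival phase: for each arriving packet in turn, the algorithm immediately accepts or drops it, and it may preempt (permanently discard) any packets in the buffer; an accepted packet is placed at the tail of the buffer, and the capacity may never be exceeded. Transmission phase: after all arrivals of the step, the packet at the head of the buffer (if any) is transmitted and its value is gained. A buffer state $B$ is a FIFO-ordered list of packets respecting the capacity, with total value $v(B)=\sum_{p\in B}v(p)$. Starting from $B$ means that before step 1 the buffer contains $B$; its packets may be transmitted (counting toward the transmitted value) or preempted like any others. $\mathrm{OPT}(B,\sigma)$ is an offline optimal schedule (maximum total transmitted value) on $\sigma$ starting from $B$. -}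

module Defs where

open import Level using (Level; _⊔_; suc)
open import Algebra.Structures using (IsAbelianGroup)
open import Data.List.Base using (List; []; _∷_; [_]; _++_; foldr; length; take; drop; map)
open import Data.List.Membership.Propositional using (_∈_)
open import Data.List.Membership.Propositional.Properties using (∈-map⁺; ∈-++⁺ˡ; ∈-++⁺ʳ)
open import Data.List.Relation.Binary.Sublist.Propositional using (_⊆_; []; _∷_; _∷ʳ_; ⊆-refl)
open import Data.List.Relation.Unary.All using (lookup)
open import Data.List.Relation.Unary.Any using (here; there)
import Data.List.Extrema as Extrema
open import Data.Nat.Base as ℕ using (ℕ)
import Data.Nat.Properties as ℕ
open import Data.Product.Base using (∃; _,_; proj₁; proj₂)
open import Relation.Binary.Bundles using (TotalOrder)
open import Relation.Binary.PropositionalEquality using (_≡_; refl)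
open import Relation.Binary.Structures using (IsTotalOrder)
open import Relation.Nullary using (yes; no; contradiction)
import Algebra.Construct.NaturalChoice.Max as Max

-- Packet values live in an arbitrary totally ordered abelian group;
-- (ℝ, +, ≤) is the motivating instance, and no other structure of ℝ is needed.

record OrderedAbelianGroup c ℓ₁ ℓ₂ : Set (suc (c ⊔ ℓ₁ ⊔ ℓ₂)) where
  infix  4 _≈_ _≤_
  infixl 6 _+_ _-_
  infix  8 -_
  field
    Carrier        : Set c
    _≈_            : Carrier → Carrier → Set ℓ₁
    _≤_            : Carrier → Carrier → Set ℓ₂
    _+_            : Carrier → Carrier → Carrier
    0#             : Carrier
    -_             : Carrier → Carrier
    isAbelianGroup : IsAbelianGroup _≈_ _+_ 0# -_
    isTotalOrder   : IsTotalOrder _≈_ _≤_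
    +-monoˡ-≤      : ∀ z {x y} → x ≤ y → x + z ≤ y + z

  open IsAbelianGroup isAbelianGroup public
    using (isEquivalence; setoid; assoc; comm; identityˡ; identityʳ; inverseˡ; inverseʳ)
    renaming (refl to ≈-refl; sym to ≈-sym; trans to ≈-trans; ∙-cong to +-cong; ⁻¹-cong to -‿cong)
  open IsTotalOrder isTotalOrder public
    using (total; antisym; ≤-respˡ-≈; ≤-respʳ-≈)
    renaming (refl to ≤-refl; reflexive to ≤-reflexive; trans to ≤-trans)

  totalOrder : TotalOrder c ℓ₁ ℓ₂
  totalOrder = record { isTotalOrder = isTotalOrder }

  _-_ : Carrier → Carrier → Carrier
  x - y = x + (- y)

  ∣_∣ : Carrier → Carrier
  ∣ x ∣ = Max._⊔_ totalOrder x (- x)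

  +-monoʳ-≤ : ∀ z {x y} → x ≤ y → z + x ≤ z + y
  +-monoʳ-≤ z {x} {y} x≤y =
    ≤-respˡ-≈ (comm x z) (≤-respʳ-≈ (comm y z) (+-monoˡ-≤ z x≤y))

module FIFO {c ℓ₁ ℓ₂ p : Level} (G : OrderedAbelianGroup c ℓ₁ ℓ₂)
            (capacity : ℕ) {Packet : Set p} (v : Packet → OrderedAbelianGroup.Carrier G) where

  open OrderedAbelianGroup G

  -- The packet at the head of the list is the head of the buffer.

  Buffer : Set p
  Buffer = List Packet

  Admissible : Buffer → Set
  Admissible B = length B ℕ.≤ capacity

  -- The i-th entry lists, in order of arrival, the packets arriving at step i;
  -- the time horizon T is the length of the input.

  Input : Set p
  Input = List (List Packet)

  total-value : List Packet → Carrier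
  total-value = foldr (λ q s → v q + s) 0#

  -- Handle B q B″: one possible reaction to the arrival of q. The packets of B
  -- missing from B′ are preempted; preemption never reorders the buffer.

  data Handle (B : Buffer) (q : Packet) : Buffer → Set p where
    reject : ∀ {B′} → B′ ⊆ B → Handle B q B′
    accept : ∀ {B′} → B′ ⊆ B → length B′ ℕ.< capacity → Handle B q (B′ ++ [ q ])

  data ArrivalPhase : Buffer → List Packet → Buffer → Set p where
    []  : ∀ {B} → ArrivalPhase B [] B
    _∷_ : ∀ {B B′ B″ q qs} →
          Handle B q B′ → ArrivalPhase B′ qs B″ → ArrivalPhase B (q ∷ qs) B″

  -- After the arrival phase the head, if any, is always transmitted, so the
  -- next step begins with drop 1 of the buffer.

  data Schedule : Buffer → Input → Set p where
    []  : ∀ {B} → Schedule B []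
    _∷_ : ∀ {B B′ qs σ} →
          ArrivalPhase B qs B′ → Schedule (drop 1 B′) σ → Schedule B (qs ∷ σ)

  transmitted : ∀ {B σ} → Schedule B σ → List Packet
  transmitted []                 = []
  transmitted (_∷_ {B′ = B′} _ S) = take 1 B′ ++ transmitted S

  value : ∀ {B σ} → Schedule B σ → Carrier
  value S = total-value (transmitted S)

  IsOptimal : ∀ {B σ} → Schedule B σ → Set (p ⊔ ℓ₂)
  IsOptimal {B} {σ} S = (S′ : Schedule B σ) → value S′ ≤ value S

  -- Optimal schedules always exist: up to proofs, there are only finitely many
  -- outcomes of an arrival phase.

  private
    sublists : (B : Buffer) → List (∃ (_⊆ B))
    sublists []      = (_ , []) ∷ []
    sublists (x ∷ B) = map (λ (_ , s) → _ , refl ∷ s) (sublists B)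
                    ++ map (λ (_ , s) → _ , x ∷ʳ s) (sublists B)

    Hits : ∀ {a} {P : Buffer → Set a} → List (∃ P) → Buffer → Set _
    Hits L B = ∃ λ w → (B , w) ∈ L

    sublists-complete : ∀ {B′ B} → B′ ⊆ B → Hits (sublists B) B′
    sublists-complete [] = _ , here refl
    sublists-complete (refl ∷ s) =
      _ , ∈-++⁺ˡ (∈-map⁺ (λ (_ , t) → _ , refl ∷ t) (proj₂ (sublists-complete s)))
    sublists-complete {B = x ∷ B} (.x ∷ʳ s) =
      _ , ∈-++⁺ʳ (map (λ (_ , t) → _ , refl ∷ t) (sublists B))
                 (∈-map⁺ (λ (_ , t) → _ , x ∷ʳ t) (proj₂ (sublists-complete s)))

    bind : ∀ {a b} {A : Set a} {B : Set b} → List A → (A → List B) → List B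
    bind []       f = []
    bind (x ∷ xs) f = f x ++ bind xs f

    ∈-bind : ∀ {a b} {A : Set a} {B : Set b} {x y} {xs : List A} (f : A → List B) →
             x ∈ xs → y ∈ f x → y ∈ bind xs f
    ∈-bind f (here refl) q = ∈-++⁺ˡ q
    ∈-bind {xs = z ∷ _} f (there i) q = ∈-++⁺ʳ (f z) (∈-bind f i q)

    reactions : ∀ {B} q → ∃ (_⊆ B) → List (∃ (Handle B q))
    reactions q (B′ , s) with length B′ ℕ.<? capacity
    ... | yes l = (_ , reject s) ∷ (_ , accept s l) ∷ []
    ... | no  _ = (_ , reject s) ∷ []

    handles : ∀ B q → List (∃ (Handle B q))
    handles B q = bind (sublists B) (reactions q)

    reject∈ : ∀ {B} q (r : ∃ (_⊆ B)) → (_ , reject (proj₂ r)) ∈ reactions q r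
    reject∈ q (B′ , s) with length B′ ℕ.<? capacity
    ... | yes _ = here refl
    ... | no  _ = here refl

    accept∈ : ∀ {B} q (r : ∃ (_⊆ B)) → length (proj₁ r) ℕ.< capacity →
              Hits (reactions q r) (proj₁ r ++ [ q ])
    accept∈ q (B′ , s) l with length B′ ℕ.<? capacity
    ... | yes _ = _ , there (here refl)
    ... | no ¬l = contradiction l ¬l

    handles-complete : ∀ {B q B′} → Handle B q B′ → Hits (handles B q) B′
    handles-complete {q = q} (reject s) =
      let _ , i = sublists-complete s in _ , ∈-bind (reactions q) i (reject∈ q _)
    handles-complete {q = q} (accept s l) =
      let _ , i = sublists-complete s
          _ , j = accept∈ q (_ , _) l
      in _ , ∈-bind (reactions q) i j

    phases : ∀ B qs → List (∃ (ArrivalPhase B qs))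
    phases B []       = (_ , []) ∷ []
    phases B (q ∷ qs) =
      bind (handles B q) λ (B′ , h) → map (λ (_ , a) → _ , h ∷ a) (phases B′ qs)

    phases-complete : ∀ {B qs B′} → ArrivalPhase B qs B′ → Hits (phases B qs) B′
    phases-complete [] = _ , here refl
    phases-complete (h ∷ a) =
      let h′ , i = handles-complete h
          _  , j = phases-complete a
      in _ , ∈-bind _ i (∈-map⁺ (λ (_ , a) → _ , h′ ∷ a) j)

    reject-all : ∀ B qs → ArrivalPhase B qs B
    reject-all B []       = []
    reject-all B (q ∷ qs) = reject ⊆-refl ∷ reject-all B qs

    total-value-mono : ∀ B {xs ys} → total-value xs ≤ total-value ys →
                       total-value (B ++ xs) ≤ total-value (B ++ ys)
    total-value-mono []      le = le
    total-value-mono (x ∷ B) le = +-monoʳ-≤ (v x) (total-value-mono B le)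

  optimal-exists : ∀ B σ → ∃ λ (S : Schedule B σ) → IsOptimal S
  optimal-exists B []       = [] , λ { [] → ≤-refl }
  optimal-exists B (qs ∷ σ) = extend best , λ
    { (_∷_ {B′ = B′} a S) →
        ≤-trans (total-value-mono (take 1 B′) (proj₂ (optimal-exists (drop 1 B′) σ) S))
                (lookup (f[xs]≤f[argmax] {f = f} start (phases B qs))
                        (proj₂ (phases-complete a))) }
    where
    open Extrema totalOrder using (argmax; f[xs]≤f[argmax])

    extend : ∃ (ArrivalPhase B qs) → Schedule B (qs ∷ σ)
    extend (B′ , a) = a ∷ proj₁ (optimal-exists (drop 1 B′) σ)

    f : ∃ (ArrivalPhase B qs) → Carrier
    f r = value (extend r)

    start best : ∃ (ArrivalPhase B qs)
    start = B , reject-all B qs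
    best  = argmax f start (phases B qs)

{-# OPTIONS --safe #-}

-- Upper bound: run on Y, a sublist of X, copying on Y every decision made on X.
-- The buffers stay nested, and gain(X) − gain(Y) + v(X) − v(Y) never increases:
-- transmission moves value from the buffers to the gains, a common arrival cancels,
-- and preemption only shrinks the complement of Y in X. Take X = B and Y = ∅.
-- Lower bound: until the first arrival a schedule from ∅ gains nothing, and at
-- that arrival the whole of B may be preempted, so B is worth at least as much as ∅.

module Submission where

open import Defs
open import Algebra.Bundles using (AbelianGroup)
import Algebra.Construct.NaturalChoice.Max as Max
import Algebra.Properties.AbelianGroup as AbelianGroupProperties
import Algebra.Properties.CommutativeSemigroup as CommutativeSemigroupProperties
open import Data.List.Base using ([]; _∷_; [_]; _++_; take; drop)
open import Data.List.Properties using (take++drop≡id)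
open import Data.List.Relation.Binary.Sublist.Propositional
  using (_⊆_; []; _∷_; _∷ʳ_; ⊆-refl; ⊆-trans; minimum)
open import Data.List.Relation.Binary.Sublist.Propositional.Properties
  using (++⁺; drop⁺-⊆; length-mono-≤)
open import Data.Nat.Base using (ℕ)
import Data.Nat.Properties as ℕ
open import Data.Product.Base using (_×_; _,_; ∃-syntax)
open import Relation.Binary.Bundles using (TotalOrder)
open import Relation.Binary.PropositionalEquality using (refl; cong)
import Relation.Binary.Reasoning.PartialOrder as PartialOrderReasoning

module OrderedAbelianGroupProperties {c ℓ₁ ℓ₂} (G : OrderedAbelianGroup c ℓ₁ ℓ₂) where

  open OrderedAbelianGroup G

  abelianGroup : AbelianGroup c ℓ₁
  abelianGroup = record { isAbelianGroup = isAbelianGroup }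

  open AbelianGroup abelianGroup using (commutativeSemigroup)
  open AbelianGroupProperties abelianGroup using (⁻¹-∙-comm; ε⁻¹≈ε; xyx⁻¹≈y)
  open CommutativeSemigroupProperties commutativeSemigroup using (interchange)
  open Max totalOrder using (x≤y⇒y⊔x≈y)
  module ≤-Reasoning = PartialOrderReasoning (TotalOrder.poset totalOrder)
  open ≤-Reasoning

  x≤y+x : ∀ {x y} → 0# ≤ y → x ≤ y + x
  x≤y+x {x} 0≤y = ≤-respˡ-≈ (identityˡ x) (+-monoˡ-≤ x 0≤y)

  0≤x⇒-x≤0 : ∀ {x} → 0# ≤ x → - x ≤ 0#
  0≤x⇒-x≤0 {x} 0≤x = ≤-respˡ-≈ (identityˡ (- x)) (≤-respʳ-≈ (inverseʳ x) (+-monoˡ-≤ (- x) 0≤x))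

  0≤y⇒x-y≤x : ∀ {x y} → 0# ≤ y → x - y ≤ x
  0≤y⇒x-y≤x {x} 0≤y = ≤-respʳ-≈ (identityʳ x) (+-monoʳ-≤ x (0≤x⇒-x≤0 0≤y))

  x-0≈x : ∀ x → x - 0# ≈ x
  x-0≈x x = ≈-trans (+-cong ≈-refl ε⁻¹≈ε) (identityʳ x)

  0≤x⇒∣x∣≈x : ∀ {x} → 0# ≤ x → ∣ x ∣ ≈ x
  0≤x⇒∣x∣≈x 0≤x = x≤y⇒y⊔x≈y (≤-trans (0≤x⇒-x≤0 0≤x) 0≤x)

  [w+x]-[y+z]≈[w-y]+[x-z] : ∀ w x y z → (w + x) - (y + z) ≈ (w - y) + (x - z)
  [w+x]-[y+z]≈[w-y]+[x-z] w x y z =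
    ≈-trans (+-cong ≈-refl (≈-sym (⁻¹-∙-comm y z))) (interchange w x (- y) (- z))

  [z+x]-[z+y]≈x-y : ∀ z x y → (z + x) - (z + y) ≈ x - y
  [z+x]-[z+y]≈x-y z x y = begin-equality
    (z + x) - (z + y)  ≈⟨ [w+x]-[y+z]≈[w-y]+[x-z] z x z y ⟩
    (z - z) + (x - y)  ≈⟨ +-cong (inverseʳ z) ≈-refl ⟩
    0# + (x - y)       ≈⟨ identityˡ (x - y) ⟩
    x - y              ∎

  [x+z]-[y+z]≈x-y : ∀ x y z → (x + z) - (y + z) ≈ x - y
  [x+z]-[y+z]≈x-y x y z =
    ≈-trans (+-cong (comm x z) (-‿cong (comm y z))) ([z+x]-[z+y]≈x-y z x y)

  -- The bookkeeping of one transmission: `w` and `y` are what the larger and the smaller buffer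
  -- send, `x` and `z` what stays behind, `s` the later gain of the smaller run.
  w+[s+[x-z]]≈[y+s]+[[w+x]-[y+z]] : ∀ w x y z s →
    w + (s + (x - z)) ≈ (y + s) + ((w + x) - (y + z))
  w+[s+[x-z]]≈[y+s]+[[w+x]-[y+z]] w x y z s = begin-equality
    w + (s + (x - z))                ≈⟨ +-cong (xyx⁻¹≈y y w) ≈-refl ⟨
    (y + w - y) + (s + (x - z))      ≈⟨ +-cong (assoc y w (- y)) ≈-refl ⟩
    (y + (w - y)) + (s + (x - z))    ≈⟨ interchange y (w - y) s (x - z) ⟩
    (y + s) + ((w - y) + (x - z))    ≈⟨ +-cong ≈-refl ([w+x]-[y+z]≈[w-y]+[x-z] w x y z) ⟨
    (y + s) + ((w + x) - (y + z))    ∎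

module FIFOProperties {c ℓ₁ ℓ₂ p} (G : OrderedAbelianGroup c ℓ₁ ℓ₂) (capacity : ℕ)
  {Packet : Set p} (v : Packet → OrderedAbelianGroup.Carrier G)
  (v≥0 : ∀ q → OrderedAbelianGroup._≤_ G (OrderedAbelianGroup.0# G) (v q)) where

  open OrderedAbelianGroup G
  open OrderedAbelianGroupProperties G
  open FIFO G capacity v
  open ≤-Reasoning

  total-value-++ : ∀ xs ys → total-value (xs ++ ys) ≈ total-value xs + total-value ys
  total-value-++ []       ys = ≈-sym (identityˡ _)
  total-value-++ (x ∷ xs) ys =
    ≈-trans (+-cong ≈-refl (total-value-++ xs ys)) (≈-sym (assoc _ _ _))

  total-value-mono : ∀ {Y X} → Y ⊆ X → total-value Y ≤ total-value X
  total-value-mono []         = ≤-refl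
  total-value-mono (refl ∷ t) = +-monoʳ-≤ _ (total-value-mono t)
  total-value-mono (x ∷ʳ t)   = ≤-trans (total-value-mono t) (x≤y+x (v≥0 x))

  total-value≥0 : ∀ X → 0# ≤ total-value X
  total-value≥0 X = total-value-mono (minimum X)

  total-value-take+drop : ∀ n xs → total-value (take n xs) + total-value (drop n xs) ≈ total-value xs
  total-value-take+drop n xs = begin-equality
    total-value (take n xs) + total-value (drop n xs)  ≈⟨ total-value-++ (take n xs) (drop n xs) ⟨
    total-value (take n xs ++ drop n xs)               ≡⟨ cong total-value (take++drop≡id n xs) ⟩
    total-value xs                                     ∎

  -- For `Y ⊆ X` this is the value of the packets of `X` outside `Y`. As a difference it needs no
  -- explicit complement list.
  gap : Buffer → Buffer → Carrier
  gap X Y = total-value X - total-value Y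

  gap-++ʳ : ∀ X Y Z → gap (X ++ Z) (Y ++ Z) ≈ gap X Y
  gap-++ʳ X Y Z = begin-equality
    gap (X ++ Z) (Y ++ Z)
      ≈⟨ +-cong (total-value-++ X Z) (-‿cong (total-value-++ Y Z)) ⟩
    (total-value X + total-value Z) - (total-value Y + total-value Z)
      ≈⟨ [x+z]-[y+z]≈x-y _ _ _ ⟩
    gap X Y ∎

  -- Z is the intersection of X′ and Y inside X.
  preempt-both : ∀ {X X′ Y} → X′ ⊆ X → Y ⊆ X →
                 ∃[ Z ] Z ⊆ X′ × Z ⊆ Y × gap X′ Z ≤ gap X Y
  preempt-both [] [] = [] , [] , [] , ≤-refl
  preempt-both {x ∷ X} {_ ∷ X′} {_ ∷ Y} (refl ∷ s) (refl ∷ t) =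
    let Z , i , j , le = preempt-both s t in
    x ∷ Z , refl ∷ i , refl ∷ j , (begin
      gap (x ∷ X′) (x ∷ Z)  ≈⟨ [z+x]-[z+y]≈x-y _ _ _ ⟩
      gap X′ Z              ≤⟨ le ⟩
      gap X Y               ≈⟨ [z+x]-[z+y]≈x-y _ _ _ ⟨
      gap (x ∷ X) (x ∷ Y)   ∎)
  preempt-both {x ∷ X} {_ ∷ X′} {Y} (refl ∷ s) (.x ∷ʳ t) =
    let Z , i , j , le = preempt-both s t in
    Z , x ∷ʳ i , j , (begin
      gap (x ∷ X′) Z   ≈⟨ assoc _ _ _ ⟩
      v x + gap X′ Z   ≤⟨ +-monoʳ-≤ (v x) le ⟩
      v x + gap X Y    ≈⟨ assoc _ _ _ ⟨
      gap (x ∷ X) Y    ∎)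
  preempt-both {x ∷ X} {X′} {_ ∷ Y} (.x ∷ʳ s) (refl ∷ t) =
    let Z , i , j , le = preempt-both s t in
    Z , i , x ∷ʳ j , (begin
      gap X′ Z             ≤⟨ le ⟩
      gap X Y              ≈⟨ [z+x]-[z+y]≈x-y _ _ _ ⟨
      gap (x ∷ X) (x ∷ Y)  ∎)
  preempt-both {x ∷ X} {X′} {Y} (.x ∷ʳ s) (.x ∷ʳ t) =
    let Z , i , j , le = preempt-both s t in
    Z , i , j , (begin
      gap X′ Z         ≤⟨ le ⟩
      gap X Y          ≤⟨ x≤y+x (v≥0 x) ⟩
      v x + gap X Y    ≈⟨ assoc _ _ _ ⟨
      gap (x ∷ X) Y    ∎)

  -- The smaller run preempts those of its packets that the larger run preempts, and accepts `q`
  -- exactly when the larger run does. The gap changes only by losing preempted packets of `X`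
  -- outside `Y`, whose values are nonnegative.
  handle-sublist : ∀ {X X′ Y q} → Y ⊆ X → Handle X q X′ →
                   ∃[ Y′ ] Handle Y q Y′ × Y′ ⊆ X′ × gap X′ Y′ ≤ gap X Y
  handle-sublist t (reject s) =
    let Z , i , j , le = preempt-both s t in
    Z , reject j , i , le
  handle-sublist {q = q} t (accept {X′} s l) =
    let Z , i , j , le = preempt-both s t in
    -- There is room for `q` because `Z` is no longer than `X′`.
    Z ++ [ q ] , accept j (ℕ.≤-<-trans (length-mono-≤ i) l) , ++⁺ i ⊆-refl ,
    ≤-respˡ-≈ (≈-sym (gap-++ʳ X′ Z [ q ])) le

  arrivals-sublist : ∀ {X X′ Y qs} → Y ⊆ X → ArrivalPhase X qs X′ →
                     ∃[ Y′ ] ArrivalPhase Y qs Y′ × Y′ ⊆ X′ × gap X′ Y′ ≤ gap X Y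
  arrivals-sublist t []      = _ , [] , t , ≤-refl
  arrivals-sublist t (h ∷ a) =
    let _ , h′ , t′ , le  = handle-sublist t h
        _ , a′ , t″ , le′ = arrivals-sublist t′ a
    in _ , h′ ∷ a′ , t″ , ≤-trans le′ le

  -- The gap acts as a potential that pays for every lead of the larger run. `Y` is arbitrary
  -- because an initially empty buffer fills up during the induction.
  schedule-sublist : ∀ {X Y σ} → Y ⊆ X → (S : Schedule X σ) →
                     ∃[ S′ ] value S ≤ value {Y} {σ} S′ + gap X Y
  schedule-sublist {X} {Y} t [] = [] , (begin
    0#            ≈⟨ inverseʳ (total-value Y) ⟨
    gap Y Y       ≤⟨ +-monoˡ-≤ _ (total-value-mono t) ⟩
    gap X Y       ≈⟨ identityˡ _ ⟨
    0# + gap X Y  ∎)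
  schedule-sublist {X} {Y} t (_∷_ {B′ = X′} a S) =
    let Y′ , a′ , t′ , le = arrivals-sublist t a
        -- Nesting survives transmission even if different heads are sent: when the head of `X′` is
        -- skipped by the embedding, `Y′` already embeds in `drop 1 X′`, and so does its tail.
        S′ , le′ = schedule-sublist (drop⁺-⊆ 1 t′) S
    in a′ ∷ S′ , (begin
      total-value (take 1 X′ ++ transmitted S)
        ≈⟨ total-value-++ (take 1 X′) _ ⟩
      total-value (take 1 X′) + value S
        ≤⟨ +-monoʳ-≤ _ le′ ⟩
      total-value (take 1 X′) + (value S′ + gap (drop 1 X′) (drop 1 Y′))
        ≈⟨ w+[s+[x-z]]≈[y+s]+[[w+x]-[y+z]] _ _ (total-value (take 1 Y′)) _ _ ⟩
      (total-value (take 1 Y′) + value S′) +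
        ((total-value (take 1 X′) + total-value (drop 1 X′)) -
         (total-value (take 1 Y′) + total-value (drop 1 Y′)))
        ≈⟨ +-cong (≈-sym (total-value-++ (take 1 Y′) _))
             (+-cong (total-value-take+drop 1 X′) (-‿cong (total-value-take+drop 1 Y′))) ⟩
      value (a′ ∷ S′) + gap X′ Y′
        ≤⟨ +-monoʳ-≤ _ le ⟩
      value (a′ ∷ S′) + gap X Y ∎)

  -- Preempting down to `Y` can be merged into the reaction itself, since room is checked only after
  -- preemption.
  handle-mono : ∀ {X Y Z q} → Y ⊆ X → Handle Y q Z → Handle X q Z
  handle-mono t (reject s)   = reject (⊆-trans s t)
  handle-mono t (accept s l) = accept (⊆-trans s t) l

  schedule-from-∅ : ∀ {σ} B (S : Schedule [] σ) → ∃[ S′ ] value S ≤ value {B} {σ} S′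
  schedule-from-∅ B []            = [] , ≤-refl
  schedule-from-∅ B ([] ∷ S)      =
    -- In an idle step `Handle` offers no chance to preempt, so `B` sends its head, a gain of at
    -- least zero, while the empty buffer sends nothing and stays empty.
    let S′ , le = schedule-from-∅ (drop 1 B) S in
    [] ∷ S′ , (begin
      value S                                    ≤⟨ le ⟩
      value S′                                   ≤⟨ x≤y+x (total-value≥0 (take 1 B)) ⟩
      total-value (take 1 B) + value S′          ≈⟨ total-value-++ (take 1 B) _ ⟨
      total-value (take 1 B ++ transmitted S′)   ∎)
  -- The first reaction also discards all of `B`. From then on the two buffers coincide and the rest
  -- is copied verbatim, with equal gain.
  schedule-from-∅ B ((h ∷ a) ∷ S) = (handle-mono (minimum B) h ∷ a) ∷ S , ≤-refl

lemma10 : ∀ {c ℓ₁ ℓ₂ p} (G : OrderedAbelianGroup c ℓ₁ ℓ₂) →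
    let open OrderedAbelianGroup G in
    (capacity : ℕ) (Packet : Set p) (v : Packet → Carrier) →
    (∀ q → 0# ≤ v q) →
    let open FIFO G capacity v in
    (B : Buffer) → Admissible B → (σ : Input) →
    (OPT-B : Schedule B σ) → IsOptimal OPT-B →
    (OPT-∅ : Schedule [] σ) → IsOptimal OPT-∅ →
    let ε = ∣ total-value B - total-value [] ∣ in
    (ε ≈ total-value B) ×
    (value OPT-∅ - ε ≤ value OPT-B) ×
    (value OPT-B ≤ value OPT-∅ + ε)
lemma10 G capacity Packet v v≥0 B _ σ OPT-B optB OPT-∅ opt∅ = ε≈v[B] , lower , upper
  where
  open OrderedAbelianGroup G
  open OrderedAbelianGroupProperties G
  open FIFO G capacity v
  open FIFOProperties G capacity v v≥0
  open ≤-Reasoning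

  gap≥0 : 0# ≤ gap B []
  gap≥0 = ≤-respʳ-≈ (≈-sym (x-0≈x _)) (total-value≥0 B)

  ε : Carrier
  ε = ∣ gap B [] ∣

  ε≈gap : ε ≈ gap B []
  ε≈gap = 0≤x⇒∣x∣≈x gap≥0

  ε≈v[B] : ε ≈ total-value B
  ε≈v[B] = ≈-trans ε≈gap (x-0≈x _)

  lower : value OPT-∅ - ε ≤ value OPT-B
  -- The chain yields the stronger bound `value OPT-∅ ≤ value OPT-B`; subtracting the nonnegative
  -- `ε` only weakens it.
  lower =
    let S , le = schedule-from-∅ B OPT-∅ in begin
    value OPT-∅ - ε  ≤⟨ 0≤y⇒x-y≤x (≤-respʳ-≈ (≈-sym ε≈gap) gap≥0) ⟩
    value OPT-∅      ≤⟨ le ⟩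
    value S          ≤⟨ optB S ⟩
    value OPT-B      ∎

  upper : value OPT-B ≤ value OPT-∅ + ε
  upper =
    let S , le = schedule-sublist (minimum B) OPT-B in begin
    value OPT-B            ≤⟨ le ⟩
    value S + gap B []     ≤⟨ +-monoˡ-≤ _ (opt∅ S) ⟩
    value OPT-∅ + gap B [] ≈⟨ +-cong ≈-refl ε≈gap ⟨
    value OPT-∅ + ε        ∎
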